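{- For any finite join-semilattice $S$, the lattice $\operatorname{Reg}S$ is a bounded homomorphic image of a free lattice.
   Context: For a join-semilattice $S$ and $\boldsymbol{x}\subseteq S$, let $\varphi(\boldsymbol{x})$ be the set of joins of all nonempty finite subsets of $\boldsymbol{x}$ (the join-subsemilattice generated). The interior is $\check\varphi(\boldsymbol{x})=S\setminus\varphi(S\setminus\boldsymbol{x})$; $\boldsymbol{x}$ is regular closed if $\boldsymbol{x}=\varphi\check\varphi(\boldsymbol{x})$. $\operatorname{Reg}S$ is the lattice of regular closed subsets of $S$ under inclusion (joins $\varphi(\bigcup)$, meets $\varphi\check\varphi(\bigcap)$). A lattice $L$ is a bounded homomorphic image of a free lattice if there is a free lattice $F$ and a surjective lattice homomorphism $f\colon F\to L$ such that each $f^{ -1}\{x\}$ has a least and a largest element. -}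

module Defs where

open import Level using (0ℓ)
open import Data.Nat using (ℕ)
open import Data.Fin using (Fin)
open import Data.Fin.Subset using (Subset; _∈_; _∉_)
open import Data.List.NonEmpty using (List⁺; foldr₁)
open import Data.List.Relation.Unary.All using (All)
open import Data.List.NonEmpty using (toList)
open import Data.Product using (Σ; ∃; _×_; _,_)
open import Data.Sum using (_⊎_)
open import Relation.Nullary using (¬_)
open import Relation.Unary using (Pred)
open import Relation.Binary.PropositionalEquality using (_≡_)
open import Function.Bundles using (_⇔_)
open import Algebra.Core using (Op₂)
open import Algebra.Lattice.Structures using (IsJoinSemilattice)

-- Finite join-semilattices.  Up to isomorphism, a finite join-semilattice
-- is a set Fin n with a binary operation _∨_ that is associative,
-- commutative and idempotent (the order being x ≤ y iff x ∨ y ≡ y).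

record FinJoinSemilattice : Set where
  field
    size   : ℕ
    _∨_    : Op₂ (Fin size)
    isJoinSemilattice : IsJoinSemilattice _≡_ _∨_

module _ (S : FinJoinSemilattice) where
  open FinJoinSemilattice S

  PSub : Set₁
  PSub = Pred (Fin size) 0ℓ

  ⋁ : List⁺ (Fin size) → Fin size
  ⋁ = foldr₁ _∨_

  φ : PSub → PSub
  φ x s = Σ (List⁺ (Fin size)) λ l → All x (toList l) × ⋁ l ≡ s

  φ̌ : PSub → PSub
  φ̌ x s = ¬ φ (λ t → ¬ x t) s

  _≐_ : PSub → PSub → Set
  x ≐ y = ∀ s → (x s ⇔ y s)

  -- regular closed subsets (subsets of the finite set S are represented
  -- as Boolean vectors, i.e. decidable subsets)
  IsRegClosed : Subset size → Set
  IsRegClosed x = (_∈ x) ≐ φ (φ̌ (_∈ x))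

  regJoin : Subset size → Subset size → PSub
  regJoin x y = φ (λ s → s ∈ x ⊎ s ∈ y)

  regMeet : Subset size → Subset size → PSub
  regMeet x y = φ (φ̌ (λ s → s ∈ x × s ∈ y))

-- Free lattice on a set X: lattice terms modulo the least congruence
-- containing the lattice axioms.

data Term (X : Set) : Set where
  var  : X → Term X
  _∨ₜ_ : Term X → Term X → Term X
  _∧ₜ_ : Term X → Term X → Term X

infixr 6 _∨ₜ_
infixr 7 _∧ₜ_
infix 4 _≈ₜ_

data _≈ₜ_ {X : Set} : Term X → Term X → Set where
  refl≈  : ∀ {t} → t ≈ₜ t
  sym≈   : ∀ {t u} → t ≈ₜ u → u ≈ₜ t
  trans≈ : ∀ {t u v} → t ≈ₜ u → u ≈ₜ v → t ≈ₜ v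
  ∨-cong : ∀ {t t′ u u′} → t ≈ₜ t′ → u ≈ₜ u′ → (t ∨ₜ u) ≈ₜ (t′ ∨ₜ u′)
  ∧-cong : ∀ {t t′ u u′} → t ≈ₜ t′ → u ≈ₜ u′ → (t ∧ₜ u) ≈ₜ (t′ ∧ₜ u′)
  ∨-assoc : ∀ t u v → ((t ∨ₜ u) ∨ₜ v) ≈ₜ (t ∨ₜ (u ∨ₜ v))
  ∧-assoc : ∀ t u v → ((t ∧ₜ u) ∧ₜ v) ≈ₜ (t ∧ₜ (u ∧ₜ v))
  ∨-comm  : ∀ t u → (t ∨ₜ u) ≈ₜ (u ∨ₜ t)
  ∧-comm  : ∀ t u → (t ∧ₜ u) ≈ₜ (u ∧ₜ t)
  ∨-absorbs-∧ : ∀ t u → (t ∨ₜ (t ∧ₜ u)) ≈ₜ t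
  ∧-absorbs-∨ : ∀ t u → (t ∧ₜ (t ∨ₜ u)) ≈ₜ t

_≤ₜ_ : {X : Set} → Term X → Term X → Set
t ≤ₜ u = (t ∧ₜ u) ≈ₜ t

record BoundedHomImage (S : FinJoinSemilattice) (X : Set) : Set₁ where
  open FinJoinSemilattice S using (size)
  field
    f          : Term X → Subset size
    f-reg      : ∀ t → IsRegClosed S (f t)
    f-wd       : ∀ {t u} → t ≈ₜ u → f t ≡ f u
    f-∨        : ∀ t u → _≐_ S (_∈ f (t ∨ₜ u)) (regJoin S (f t) (f u))
    f-∧        : ∀ t u → _≐_ S (_∈ f (t ∧ₜ u)) (regMeet S (f t) (f u))
    surjective : ∀ x → IsRegClosed S x → ∃ λ t → f t ≡ x
    lower      : ∀ t → ∃ λ b → f b ≡ f t × (∀ u → f u ≡ f t → b ≤ₜ u)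
    upper      : ∀ t → ∃ λ b → f b ≡ f t × (∀ u → f u ≡ f t → u ≤ₜ b)

IsBoundedHomImageOfFreeLattice : FinJoinSemilattice → Set₁
IsBoundedHomImageOfFreeLattice S = Σ Set λ X → BoundedHomImage S X

{-# OPTIONS --safe #-}

-- A minimal open neighbourhood u of p ("key") is clopen and contained in ↓p, and the keys
-- generate every regular closed set under joins.  If u is covered by V ⊔ W but by neither
-- V nor W, then u already lies in the closure of the elements of int V ∪ int W strictly
-- below p.  So nontrivial join covers of keys refine to keys with strictly smaller top, and
-- the usual recursion yields, for each regular closed set, a least term evaluating to it.
-- Greatest terms follow by duality, since Reg S is an ortholattice.

module Submission where

open import Defs

open import Algebra.Lattice.Structures using (IsJoinSemilattice)
import Algebra.Lattice.Bundles as Alg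
import Algebra.Lattice.Properties.Lattice as LatticeProperties
import Algebra.Lattice.Properties.Semilattice as SemilatticeProperties
open import Data.Bool using (Bool; true; false)
open import Data.Empty using (⊥-elim)
open import Data.Fin using (Fin)
open import Data.Fin.Properties using (_≟_; any?; all?)
open import Data.Fin.Subset using (Subset; inside; outside; _∈_; _∉_; _⊆_; _⊈_; _⊂_; _∪_; _∩_; ∁; ⊥; ∣_∣)
open import Data.Fin.Subset.Induction using (⊂-wellFounded)
open import Data.Fin.Subset.Properties
open import Data.List using (List; []; _∷_; filter; allFin; foldr; map; _++_; cartesianProduct; cartesianProductWith)
open import Data.List.Membership.Propositional using () renaming (_∈_ to _∈ˡ_)
open import Data.List.Membership.Propositional.Properties
  using (∈-filter⁺; ∈-filter⁻; ∈-allFin; ∈-map⁺; ∈-map⁻; ∈-++⁺ˡ; ∈-++⁺ʳ; ∈-cartesianProduct⁺; ∈-cartesianProductWith⁺)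
open import Data.List.NonEmpty using (toList; _⁺++⁺_) renaming (_∷_ to _∷⁺_)
open import Data.List.Relation.Unary.All as All using (All; []; _∷_)
open import Data.List.Relation.Unary.All.Properties using (all-filter; ++⁺)
open import Data.List.Relation.Unary.Any using (here; there)
open import Data.Nat as ℕ using (ℕ; zero; suc; s≤s)
open import Data.Nat.Properties using (<-≤-trans)
open import Data.Product using (∃; _×_; _,_; proj₁; proj₂)
open import Data.Sum using (_⊎_; inj₁; inj₂; [_,_]′)
open import Data.Vec using (tabulate; []; _∷_)
open import Data.Vec.Properties using (lookup⇒[]=; []=⇒lookup; lookup∘tabulate)
open import Function using (_∘_; id)
open import Function.Bundles using (_⇔_; mk⇔; Equivalence)
open import Induction.WellFounded using (Acc; acc)
import Relation.Binary.Lattice as Ord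
import Relation.Binary.Lattice.Properties.Lattice as OrdLatticeProperties
open import Relation.Binary.PropositionalEquality using (_≡_; _≢_; refl; sym; trans; cong; cong₂; subst; module ≡-Reasoning)
open import Relation.Nullary using (¬_; Dec; yes; no; does)
open import Relation.Nullary.Decidable using (_×-dec_; _⊎-dec_; _→-dec_; ¬?; dec-true; decidable-stable)
open import Relation.Unary using (Pred; Decidable)

open Equivalence using (to; from)

-- Decidable subsets of a finite set.

module _ {n} {P : Fin n → Set} (P? : Decidable P) where

  comprehension : Subset n
  comprehension = tabulate (does ∘ P?)

  ∈-comprehension⁺ : ∀ {s} → P s → s ∈ comprehension
  ∈-comprehension⁺ {s} Ps =
    lookup⇒[]= s comprehension (trans (lookup∘tabulate (does ∘ P?) s) (dec-true (P? s) Ps))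

  ∈-comprehension⁻ : ∀ {s} → s ∈ comprehension → P s
  ∈-comprehension⁻ {s} s∈ with P? s | trans (sym (lookup∘tabulate (does ∘ P?) s)) ([]=⇒lookup s∈)
  ... | yes Ps | _ = Ps
  ... | no _   | ()

∁-involutive : ∀ {n} (x : Subset n) → ∁ (∁ x) ≡ x
∁-involutive x = ⊆-antisym
  (λ s∈ → x∉∁p⇒x∈p (x∈∁p⇒x∉p s∈))
  (λ s∈ → x∉p⇒x∈∁p (x∈p⇒x∉∁p s∈))

⊈⇒∃ : ∀ {n} {x y : Subset n} → x ⊈ y → ∃ λ s → s ∈ x × s ∉ y
⊈⇒∃ {n} {x} {y} x⊈y with any? (λ s → (s ∈? x) ×-dec ¬? (s ∈? y))
... | yes found = found
... | no none = ⊥-elim (x⊈y λ {s} s∈x → decidable-stable (s ∈? y) λ s∉y → none (s , s∈x , s∉y))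

-- Order and join-closure in a finite join-semilattice.

module RegularClosed (S : FinJoinSemilattice) where
  open FinJoinSemilattice S

  joinSemilattice : Ord.JoinSemilattice _ _ _
  joinSemilattice = SemilatticeProperties.∧-orderTheoreticJoinSemilattice
    (record { isSemilattice = isJoinSemilattice })

  open Ord.JoinSemilattice joinSemilattice
    using (_≤_; x≤x∨y; y≤x∨y; ∨-least; antisym)
    renaming (refl to ≤-refl; trans to ≤-trans)
  open IsJoinSemilattice _≡_ isJoinSemilattice using (comm; assoc)

  -- The order `s ≤ t` unfolds to `t ≡ t ∨ s`; later proofs use inequalities directly as such
  -- equations.
  _≤?_ : ∀ s t → Dec (s ≤ t)
  s ≤? t = t ≟ (t ∨ s)

  ClosedP : Pred (Fin size) _ → Set
  ClosedP P = ∀ a b → P a → P b → P (a ∨ b)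

  φ-least : ∀ {P Q : Fin size → Set} → ClosedP Q → (∀ {s} → P s → Q s) → ∀ {s} → φ S P s → Q s
  φ-least {P} {Q} closed P⊆Q ((a ∷⁺ as) , Pas , refl) = go a as Pas
    where
    go : ∀ a as → All P (a ∷ as) → Q (⋁ S (a ∷⁺ as))
    go a [] (Pa ∷ []) = P⊆Q Pa
    go a (b ∷ as) (Pa ∷ Pas) = closed _ _ (P⊆Q Pa) (go b as Pas)

  ⋁-⁺++⁺ : ∀ l m → ⋁ S (l ⁺++⁺ m) ≡ ⋁ S l ∨ ⋁ S m
  ⋁-⁺++⁺ (a ∷⁺ as) m = go a as
    where
    go : ∀ a as → ⋁ S ((a ∷⁺ as) ⁺++⁺ m) ≡ ⋁ S (a ∷⁺ as) ∨ ⋁ S m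
    go a [] = refl
    go a (b ∷ as) = trans (cong (a ∨_) (go b as)) (sym (assoc a _ _))

  φ-extensive : ∀ {P : Fin size → Set} {s} → P s → φ S P s
  φ-extensive {s = s} Ps = (s ∷⁺ []) , (Ps ∷ []) , refl

  φ-closed : ∀ {P : Fin size → Set} → ClosedP (φ S P)
  φ-closed a b ((c ∷⁺ cs) , Pl , refl) ((d ∷⁺ ds) , Pm , refl) =
    (c ∷⁺ cs) ⁺++⁺ (d ∷⁺ ds) , ++⁺ Pl Pm , ⋁-⁺++⁺ (c ∷⁺ cs) (d ∷⁺ ds)

  φ-mono : ∀ {P Q : Fin size → Set} → (∀ {s} → P s → Q s) → ∀ {s} → φ S P s → φ S Q s
  φ-mono P⊆Q = φ-least φ-closed (φ-extensive ∘ P⊆Q)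

  ≤-⋁ : ∀ {t} l → t ∈ˡ toList l → t ≤ ⋁ S l
  ≤-⋁ (a ∷⁺ as) = go a as
    where
    go : ∀ {t} a as → t ∈ˡ (a ∷ as) → t ≤ ⋁ S (a ∷⁺ as)
    go a []       (here refl) = ≤-refl
    go a (b ∷ as) (here refl) = x≤x∨y _ _
    go a (b ∷ as) (there t∈)  = ≤-trans (go b as t∈) (y≤x∨y _ _)

  -- The entries of a list lie below its join. This bounds the generators needed for `s`, which
  -- makes `φ` decidable and lets covers be refined downwards.
  φ-below : ∀ {P : Fin size → Set} {s} → φ S P s → φ S (λ t → P t × t ≤ s) s
  φ-below (l , Pl , refl) = l , All.tabulate (λ t∈ → All.lookup Pl t∈ , ≤-⋁ l t∈) , refl

  -- An element lies in φ P iff it is the join of all elements of P below it.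
  φ? : ∀ {P : Fin size → Set} → Decidable P → Decidable (φ S P)
  φ? {P} P? s = decide (filter Q? (allFin size)) (all-filter Q? (allFin size))
                       (λ Qt → ∈-filter⁺ Q? (∈-allFin _) Qt)
    where
    Q : Fin size → Set
    Q t = P t × t ≤ s
    Q? : Decidable Q
    Q? t = P? t ×-dec (t ≤? s)
    decide : ∀ l → All Q l → (∀ {t} → Q t → t ∈ˡ l) → Dec (φ S P s)
    decide [] _ complete = no λ φs → none (φ-below φs)
      where
      none : ¬ φ S Q s
      none ((a ∷⁺ _) , (Qa ∷ _) , _) with () ← complete Qa
    decide (a ∷ as) Qas complete with ⋁ S (a ∷⁺ as) ≟ s
    ... | yes eq = yes ((a ∷⁺ as) , All.map proj₁ Qas , eq)
    ... | no neq = no λ φs → neq (antisym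
            (φ-least {P = Q} (λ _ _ → ∨-least) proj₂ ((a ∷⁺ as) , Qas , refl))
            (φ-least (λ _ _ → ∨-least) (≤-⋁ (a ∷⁺ as) ∘ complete) (φ-below φs)))

  -- Closed, open and regular closed subsets.

  Closed : Subset size → Set
  Closed x = ∀ a b → a ∈ x → b ∈ x → (a ∨ b) ∈ x

  Open : Subset size → Set
  Open x = Closed (∁ x)

  opaque

    cl : Subset size → Subset size
    cl x = comprehension (φ? (_∈? x))

    ∈-cl : ∀ {x s} → φ S (_∈ x) s ⇔ s ∈ cl x
    ∈-cl {x} = mk⇔ (∈-comprehension⁺ (φ? (_∈? x))) (∈-comprehension⁻ (φ? (_∈? x)))

  cl-extensive : ∀ {x} → x ⊆ cl x
  cl-extensive s∈x = to ∈-cl (φ-extensive s∈x)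

  cl-closed : ∀ x → Closed (cl x)
  cl-closed x a b a∈ b∈ = to ∈-cl (φ-closed a b (from ∈-cl a∈) (from ∈-cl b∈))

  cl-least : ∀ {x y} → Closed y → x ⊆ y → cl x ⊆ y
  cl-least closed x⊆y s∈ = φ-least closed x⊆y (from ∈-cl s∈)

  cl-mono : ∀ {x y} → x ⊆ y → cl x ⊆ cl y
  cl-mono x⊆y = cl-least (cl-closed _) (λ s∈ → cl-extensive (x⊆y s∈))

  cl-of-closed : ∀ {x} → Closed x → cl x ≡ x
  cl-of-closed closed = ⊆-antisym (cl-least closed id) cl-extensive

  int : Subset size → Subset size
  int x = ∁ (cl (∁ x))

  int-⊆ : ∀ {x} → int x ⊆ x
  int-⊆ s∈ = x∉∁p⇒x∈p (λ s∈∁x → x∈∁p⇒x∉p s∈ (cl-extensive s∈∁x))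

  int-mono : ∀ {x y} → x ⊆ y → int x ⊆ int y
  int-mono x⊆y = p⊆q⇒∁p⊇∁q (cl-mono (p⊆q⇒∁p⊇∁q x⊆y))

  int-open : ∀ x → Open (int x)
  int-open x = subst Closed (sym (∁-involutive _)) (cl-closed (∁ x))

  int-of-open : ∀ {x} → Open x → int x ≡ x
  int-of-open open-x = trans (cong ∁ (cl-of-closed open-x)) (∁-involutive _)

  reg : Subset size → Subset size
  reg x = cl (int x)

  Regular : Subset size → Set
  Regular x = reg x ≡ x

  reg-mono : ∀ {x y} → x ⊆ y → reg x ⊆ reg y
  reg-mono x⊆y = cl-mono (int-mono x⊆y)

  reg-⊆ : ∀ {x} → Closed x → reg x ⊆ x
  reg-⊆ closed = cl-least closed int-⊆

  ⊆-reg : ∀ {u x} → Open u → u ⊆ x → cl u ⊆ reg x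
  ⊆-reg {u} {x} open-u u⊆x = cl-mono (subst (_⊆ int x) (int-of-open open-u) (int-mono u⊆x))

  cl-open-regular : ∀ {u} → Open u → Regular (cl u)
  cl-open-regular open-u = ⊆-antisym (reg-⊆ (cl-closed _)) (⊆-reg open-u cl-extensive)

  reg-regular : ∀ x → Regular (reg x)
  reg-regular x = cl-open-regular (int-open x)

  regular-closed : ∀ {x} → Regular x → Closed x
  regular-closed reg-x = subst Closed reg-x (cl-closed _)

  -- Lattice operations and orthocomplement of regular closed sets.

  infix 6 _⊔_ _⊓_
  _⊔_ _⊓_ : Subset size → Subset size → Subset size
  x ⊔ y = cl (x ∪ y)
  x ⊓ y = reg (x ∩ y)

  ⊔-least : ∀ {x y z} → Closed z → x ⊆ z → y ⊆ z → x ⊔ y ⊆ z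
  ⊔-least {x} {y} closed x⊆z y⊆z = cl-least closed (λ s∈ → [ x⊆z , y⊆z ]′ (x∈p∪q⁻ x y s∈))

  x⊆x⊔y : ∀ x y → x ⊆ x ⊔ y
  x⊆x⊔y x y s∈ = cl-extensive (p⊆p∪q y s∈)

  y⊆x⊔y : ∀ x y → y ⊆ x ⊔ y
  y⊆x⊔y x y s∈ = cl-extensive (q⊆p∪q x y s∈)

  ⊔-regular : ∀ {x y} → Regular x → Regular y → Regular (x ⊔ y)
  ⊔-regular {x} {y} reg-x reg-y = ⊆-antisym (reg-⊆ (cl-closed _))
    (⊔-least (cl-closed _) (subst (_⊆ reg (x ⊔ y)) reg-x (reg-mono (x⊆x⊔y x y)))
                           (subst (_⊆ reg (x ⊔ y)) reg-y (reg-mono (y⊆x⊔y x y))))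

  x⊓y⊆x : ∀ {x} → Regular x → ∀ y → x ⊓ y ⊆ x
  x⊓y⊆x {x} reg-x y = subst (x ⊓ y ⊆_) reg-x (reg-mono (p∩q⊆p x y))

  x⊓y⊆y : ∀ x {y} → Regular y → x ⊓ y ⊆ y
  x⊓y⊆y x {y} reg-y = subst (x ⊓ y ⊆_) reg-y (reg-mono (p∩q⊆q x y))

  ⊓-greatest : ∀ {x y z} → Regular z → z ⊆ x → z ⊆ y → z ⊆ x ⊓ y
  ⊓-greatest {x} {y} reg-z z⊆x z⊆y =
    subst (_⊆ x ⊓ y) reg-z (reg-mono (λ s∈ → x∈p∩q⁺ (z⊆x s∈ , z⊆y s∈)))

  infix 8 _ᵖ
  _ᵖ : Subset size → Subset size
  x ᵖ = cl (∁ x)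

  ᵖ-antitone : ∀ {x y} → x ⊆ y → y ᵖ ⊆ x ᵖ
  ᵖ-antitone x⊆y = cl-mono (p⊆q⇒∁p⊇∁q x⊆y)

  ᵖ-regular : ∀ {x} → Regular x → Regular (x ᵖ)
  ᵖ-regular {x} reg-x = cl-open-regular (subst Closed (sym (∁-involutive x)) (regular-closed reg-x))

  -- `x ᵖ ᵖ` unfolds to `reg x`, so the involution law is regularity itself.
  ᵖ-involutive : ∀ {x} → Regular x → x ᵖ ᵖ ≡ x
  ᵖ-involutive reg-x = reg-x

  -- Agreement with the predicates of the statement.

  φφ̌⇔∈-reg : ∀ {P : Fin size → Set} {x} → (∀ {t} → P t ⇔ t ∈ x) → ∀ s → φ S (φ̌ S P) s ⇔ s ∈ reg x
  φφ̌⇔∈-reg {P} {x} P⇔x s = mk⇔ (to ∈-cl ∘ φ-mono φ̌⇒int) (φ-mono int⇒φ̌ ∘ from ∈-cl)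
    where
    φ̌⇒int : ∀ {t} → φ̌ S P t → t ∈ int x
    φ̌⇒int ¬φ = x∉p⇒x∈∁p λ t∈ → ¬φ (φ-mono (λ s∈∁x Ps → x∈∁p⇒x∉p s∈∁x (to P⇔x Ps)) (from ∈-cl t∈))
    int⇒φ̌ : ∀ {t} → t ∈ int x → φ̌ S P t
    int⇒φ̌ t∈ φt = x∈∁p⇒x∉p t∈ (to ∈-cl (φ-mono (λ ¬Ps → x∉p⇒x∈∁p (¬Ps ∘ from P⇔x)) φt))

  regular⇒isRegClosed : ∀ {x} → Regular x → IsRegClosed S x
  regular⇒isRegClosed {x} reg-x s = mk⇔
    (λ s∈x → from (φφ̌⇔∈-reg (mk⇔ id id) s) (subst (s ∈_) (sym reg-x) s∈x))
    (λ φs → subst (s ∈_) reg-x (to (φφ̌⇔∈-reg (mk⇔ id id) s) φs))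

  isRegClosed⇒regular : ∀ {x} → IsRegClosed S x → Regular x
  isRegClosed⇒regular {x} h = ⊆-antisym
    (λ {s} s∈ → from (h s) (from (φφ̌⇔∈-reg (mk⇔ id id) s) s∈))
    (λ {s} s∈ → to (φφ̌⇔∈-reg (mk⇔ id id) s) (to (h s) s∈))

  ∈-⊔ : ∀ x y → _≐_ S (_∈ (x ⊔ y)) (regJoin S x y)
  ∈-⊔ x y s = mk⇔ (φ-mono (x∈p∪q⁻ x y) ∘ from ∈-cl) (to ∈-cl ∘ φ-mono x∈p∪q⁺)

  ∈-⊓ : ∀ x y → _≐_ S (_∈ (x ⊓ y)) (regMeet S x y)
  ∈-⊓ x y s = mk⇔ (from (φφ̌⇔∈-reg ×⇔∩ s)) (to (φφ̌⇔∈-reg ×⇔∩ s))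
    where
    ×⇔∩ : ∀ {t} → (t ∈ x × t ∈ y) ⇔ t ∈ x ∩ y
    ×⇔∩ = mk⇔ x∈p∩q⁺ (x∈p∩q⁻ x y)

  -- Minimal open neighbourhoods.

  -- For open `u`, the join-closure of `∁ u` with `a` added consists of `∁ u` and the `p` with
  -- `Split u p a`; a single `m` suffices because `∁ u` is join-closed.
  Split : Subset size → Fin size → Fin size → Set
  Split u p a = p ≡ a ⊎ ∃ λ m → m ∉ u × p ≡ a ∨ m

  split? : ∀ u p a → Dec (Split u p a)
  split? u p a = (p ≟ a) ⊎-dec any? (λ m → ¬? (m ∈? u) ×-dec (p ≟ (a ∨ m)))

  -- u is an open neighbourhood of p that is minimal, as p is generated by the
  -- complement of u together with any single element of u.
  Key : Subset size → Fin size → Set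
  Key u p = p ∈ u × Open u × (∀ a → a ∈ u → Split u p a)

  open-split : ∀ {u} → Open u → ∀ {a b} → (a ∨ b) ∈ u → a ∉ u → b ∈ u
  open-split {u} open-u {a} {b} ab∈u a∉u with b ∈? u
  ... | yes b∈u = b∈u
  ... | no b∉u = ⊥-elim (x∈∁p⇒x∉p (open-u a b (x∉p⇒x∈∁p a∉u) (x∉p⇒x∈∁p b∉u)) ab∈u)

  key? : ∀ u p → Dec (Key u p)
  key? u p = (p ∈? u)
    ×-dec all? (λ a → all? λ b → (a ∈? ∁ u) →-dec ((b ∈? ∁ u) →-dec ((a ∨ b) ∈? ∁ u)))
    ×-dec all? (λ a → (a ∈? u) →-dec split? u p a)

  split-≤ : ∀ {u p a} → Split u p a → a ≤ p
  split-≤ (inj₁ refl) = ≤-refl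
  split-≤ (inj₂ (_ , _ , refl)) = x≤x∨y _ _

  -- A key is clopen. If `p ≡ a ∨ m` with `m ∉ u`, then `b ≤ p` gives `p ≡ m ∨ (a ∨ b)`, and
  -- openness at `p` forces `a ∨ b` into `u`.
  key-regular : ∀ {u p} → Key u p → Regular u
  key-regular {u} {p} (p∈u , open-u , split) =
    trans (cong cl (int-of-open open-u)) (cl-of-closed closed)
    where
    closed : Closed u
    closed a b a∈u b∈u with split a a∈u
    ... | inj₁ refl = subst (_∈ u) (split-≤ (split b b∈u)) p∈u
    ... | inj₂ (m , m∉u , p≡a∨m) = open-split open-u (subst (_∈ u) p≡m∨ab p∈u) m∉u
      where
      open ≡-Reasoning
      p≡m∨ab : p ≡ m ∨ (a ∨ b)
      p≡m∨ab = begin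
        p            ≡⟨ split-≤ (split b b∈u) ⟩
        p ∨ b        ≡⟨ cong (_∨ b) p≡a∨m ⟩
        (a ∨ m) ∨ b  ≡⟨ cong (_∨ b) (comm a m) ⟩
        (m ∨ a) ∨ b  ≡⟨ assoc m a b ⟩
        m ∨ (a ∨ b)  ∎

  -- The elements s with Split u s a are those that a adds to the complement of u,
  -- so deleting them leaves an open set.
  module _ {u : Subset size} (open-u : Open u) (a : Fin size) where

    shrink : Subset size
    shrink = u ∩ comprehension (λ s → ¬? (split? u s a))

    private
      ∉-∨ : ∀ {b c} → b ∉ u → c ∉ u → (b ∨ c) ∉ u
      ∉-∨ b∉u c∉u bc∈u = c∉u (open-split open-u bc∈u b∉u)

      split-∨-∉ : ∀ {s m} → Split u s a → m ∉ u → Split u (s ∨ m) a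
      split-∨-∉ (inj₁ refl) m∉u = inj₂ (_ , m∉u , refl)
      split-∨-∉ (inj₂ (k , k∉u , refl)) m∉u = inj₂ (_ , ∉-∨ k∉u m∉u , assoc a k _)

      split-∨ : ∀ {s t} → Split u s a → Split u t a → Split u (s ∨ t) a
      split-∨ σ (inj₁ refl) = subst (λ r → Split u r a) (split-≤ σ) σ
      split-∨ {s} σ (inj₂ (m , m∉u , refl)) =
        subst (λ r → Split u r a) (trans (cong (_∨ m) (split-≤ σ)) (assoc s a m)) (split-∨-∉ σ m∉u)

    ∈-shrink : ∀ {s} → s ∈ u → ¬ Split u s a → s ∈ shrink
    ∈-shrink s∈u ¬σ = x∈p∩q⁺ (s∈u , ∈-comprehension⁺ (λ s → ¬? (split? u s a)) ¬σ)

    shrink-⊆ : shrink ⊆ u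
    shrink-⊆ = p∩q⊆p u _

    ∉-shrink : ∀ {s} → s ∉ shrink → s ∉ u ⊎ Split u s a
    ∉-shrink {s} s∉ with s ∈? u | split? u s a
    ... | no s∉u  | _      = inj₁ s∉u
    ... | yes _   | yes σ  = inj₂ σ
    ... | yes s∈u | no ¬σ  = ⊥-elim (s∉ (∈-shrink s∈u ¬σ))

    split-∉-shrink : ∀ {s} → Split u s a → s ∉ shrink
    split-∉-shrink σ s∈ = ∈-comprehension⁻ (λ s → ¬? (split? u s a)) (proj₂ (x∈p∩q⁻ u _ s∈)) σ

    shrink-open : Open shrink
    shrink-open b c b∈ c∈ =
      x∉p⇒x∈∁p (join (∉-shrink (x∈∁p⇒x∉p b∈)) (∉-shrink (x∈∁p⇒x∉p c∈)))
      where
      join : b ∉ u ⊎ Split u b a → c ∉ u ⊎ Split u c a → (b ∨ c) ∉ shrink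
      join (inj₁ b∉u) (inj₁ c∉u) bc∈ = ∉-∨ b∉u c∉u (shrink-⊆ bc∈)
      join (inj₁ b∉u) (inj₂ τ) = split-∉-shrink (subst (λ r → Split u r a) (comm c b) (split-∨-∉ τ b∉u))
      join (inj₂ σ) (inj₁ c∉u) = split-∉-shrink (split-∨-∉ σ c∉u)
      join (inj₂ σ) (inj₂ τ) = split-∉-shrink (split-∨ σ τ)

  -- If some `a ∈ v` fails to split `p`, shrinking by `a` drops `a` but keeps `p`. This descent ends
  -- at an open set that is a key for `p`.
  key-inside : ∀ v {p} → Open v → p ∈ v → ∃ λ u → u ⊆ v × Key u p
  key-inside v = go v (⊂-wellFounded v)
    where
    go : ∀ v → Acc _⊂_ v → ∀ {p} → Open v → p ∈ v → ∃ λ u → u ⊆ v × Key u p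
    go v (acc rec) {p} open-v p∈v with any? (λ a → (a ∈? v) ×-dec ¬? (split? v p a))
    ... | no none = v , id , p∈v , open-v ,
            λ a a∈v → decidable-stable (split? v p a) λ ¬σ → none (a , a∈v , ¬σ)
    ... | yes (a , a∈v , ¬σ)
      with u , u⊆ , key ← go (shrink open-v a)
                             (rec (shrink-⊆ open-v a , a , a∈v , split-∉-shrink open-v a (inj₁ refl)))
                             (shrink-open open-v a) (∈-shrink open-v a p∈v ¬σ)
      = u , (λ s∈ → shrink-⊆ open-v a (u⊆ s∈)) , key

  -- Rank, and refinement of join covers of keys.

  _<_ : Fin size → Fin size → Set
  s < t = s ≤ t × s ≢ t

  -- Counting the elements below `p` turns strict descent in the semilattice into descent on a
  -- number bounded by `size`.
  rank : Fin size → ℕ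
  rank p = ∣ comprehension (_≤? p) ∣

  rank-≤ : ∀ p → rank p ℕ.≤ size
  rank-≤ p = ∣p∣≤n (comprehension (_≤? p))

  rank-mono : ∀ {s t} → s < t → rank s ℕ.< rank t
  rank-mono {s} {t} (s≤t , s≢t) = p⊂q⇒∣p∣<∣q∣
    ( (λ r∈ → ∈-comprehension⁺ (_≤? t) (≤-trans (∈-comprehension⁻ (_≤? s) r∈) s≤t))
    , t , ∈-comprehension⁺ (_≤? t) ≤-refl
    , λ t∈ → s≢t (antisym s≤t (∈-comprehension⁻ (_≤? s) t∈)))

  -- If p itself lies in int V, pick a ∈ u outside V and write p = a ∨ m with m ∉ u:
  -- then m ∈ V as V is open at p, so p is still generated by elements strictly below it.
  key-cover : ∀ {u p V W} → Key u p → Regular V → Regular W →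
              u ⊈ V → u ⊈ W → u ⊆ V ⊔ W →
              ∀ {s} → s ∈ u → φ S (λ x → (x ∈ int V ⊎ x ∈ int W) × x < p) s
  key-cover {u} {p} {V} {W} (p∈u , open-u , split) reg-V reg-W u⊈V u⊈W u⊆V⊔W = cover
    where
    P Q : Fin size → Set
    P x = x ∈ int V ⊎ x ∈ int W
    Q x = P x × x < p

    generated : ∀ {s} → s ∈ u → φ S (λ x → P x × x ≤ s) s
    generated s∈u = φ-below (φ-least φ-closed each (from ∈-cl (u⊆V⊔W s∈u)))
      where
      each : ∀ {x} → x ∈ V ∪ W → φ S P x
      each {x} x∈ with x∈p∪q⁻ V W x∈
      ... | inj₁ x∈V = φ-mono inj₁ (from ∈-cl (subst (x ∈_) (sym reg-V) x∈V))
      ... | inj₂ x∈W = φ-mono inj₂ (from ∈-cl (subst (x ∈_) (sym reg-W) x∈W))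

    below : ∀ {s} → s ∈ u → s ≢ p → φ S Q s
    below s∈u s≢p = φ-mono
      (λ (Px , x≤s) → Px , ≤-trans x≤s s≤p , λ { refl → s≢p (antisym s≤p x≤s) })
      (generated s∈u)
      where s≤p = split-≤ (split _ s∈u)

    top : ∀ {Z} → (∀ {x} → x ∈ int Z → P x) → u ⊈ Z → p ∈ int Z → φ S Q p
    top {Z} Z⇒P u⊈Z p∈Z with ⊈⇒∃ u⊈Z
    ... | a , a∈u , a∉Z with split a a∈u
    ... | inj₁ refl = ⊥-elim (a∉Z (int-⊆ p∈Z))
    ... | inj₂ (m , m∉u , refl) =
      φ-closed a m (below a∈u λ eq → a∉Z (int-⊆ (subst (_∈ int Z) (sym eq) p∈Z)))
        (φ-extensive (Z⇒P m∈Z , y≤x∨y a m , λ m≡p → m∉u (subst (_∈ u) (sym m≡p) p∈u)))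
      where
      m∈Z : m ∈ int Z
      m∈Z = open-split (int-open Z) p∈Z (λ a∈ → a∉Z (int-⊆ a∈))

    cover : ∀ {s} → s ∈ u → φ S Q s
    cover {s} s∈u with s ≟ p | p ∈? int V | p ∈? int W
    ... | no s≢p   | _       | _       = below s∈u s≢p
    ... | yes refl | yes p∈V | _       = top inj₁ u⊈V p∈V
    ... | yes refl | no _    | yes p∈W = top inj₂ u⊈W p∈W
    -- Here `p` is in neither interior, so each generator below `p` differs from `p`.
    ... | yes refl | no p∉V  | no p∉W  = φ-mono
      (λ (Px , x≤p) → Px , x≤p , λ { refl → [ p∉V , p∉W ]′ Px })
      (generated s∈u)

-- Enumeration of subsets; finite meets and joins of terms.

subsets : ∀ n → List (Subset n)
subsets zero    = [] ∷ []
subsets (suc n) = map (inside ∷_) (subsets n) ++ map (outside ∷_) (subsets n)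

∈-subsets : ∀ {n} (x : Subset n) → x ∈ˡ subsets n
∈-subsets [] = here refl
∈-subsets (inside ∷ x)  = ∈-++⁺ˡ (∈-map⁺ (inside ∷_) (∈-subsets x))
∈-subsets {suc n} (outside ∷ x) =
  ∈-++⁺ʳ (map (inside ∷_) (subsets n)) (∈-map⁺ (outside ∷_) (∈-subsets x))

module FreeLattice (X : Set) where

  termLattice : Alg.Lattice _ _
  termLattice = record
    { Carrier = Term X
    ; isLattice = record
      { isEquivalence = record { refl = refl≈ ; sym = sym≈ ; trans = trans≈ }
      ; ∨-comm = ∨-comm ; ∨-assoc = ∨-assoc ; ∨-cong = ∨-cong
      ; ∧-comm = ∧-comm ; ∧-assoc = ∧-assoc ; ∧-cong = ∧-cong
      ; absorptive = ∨-absorbs-∧ , ∧-absorbs-∨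
      }
    }

  open Ord.Lattice (LatticeProperties.∨-∧-orderTheoreticLattice termLattice) public
    using (_≤_; x≤x∨y; y≤x∨y; ∨-least; x∧y≤x; x∧y≤y; ∧-greatest)
    renaming (refl to ≤-refl; trans to ≤-trans)

  -- Terms have no constants for top and bottom, so a seed term stands in for the empty meet or
  -- join.
  ⋀ ⋁ₜ : Term X → List (Term X) → Term X
  ⋀  = foldr _∧ₜ_
  ⋁ₜ = foldr _∨ₜ_

  ⋀-≤ : ∀ {s t ts} → t ∈ˡ ts → ⋀ s ts ≤ t
  ⋀-≤ (here refl) = x∧y≤x _ _
  ⋀-≤ (there t∈)  = ≤-trans (x∧y≤y _ _) (⋀-≤ t∈)

  ≤-⋁ : ∀ {s t ts} → t ∈ˡ ts → t ≤ ⋁ₜ s ts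
  ≤-⋁ (here refl) = x≤x∨y _ _
  ≤-⋁ (there t∈)  = ≤-trans (≤-⋁ t∈) (y≤x∨y _ _)

  ⋁-least : ∀ {s t ts} → s ≤ t → (∀ {u} → u ∈ˡ ts → u ≤ t) → ⋁ₜ s ts ≤ t
  ⋁-least {ts = []}     s≤t _    = s≤t
  ⋁-least {ts = _ ∷ _} s≤t ts≤t = ∨-least (ts≤t (here refl)) (⋁-least s≤t (ts≤t ∘ there))

-- Evaluation of terms at regular closed sets.

module Evaluation (S : FinJoinSemilattice) where
  open FinJoinSemilattice S using (size)
  open RegularClosed S hiding (_≤?_; ≤-⋁)

  -- Equality ignores the regularity proofs; the algebraic lattice laws then follow from suprema and
  -- infima alone.
  regLattice : Ord.Lattice _ _ _
  regLattice = record
    { Carrier = ∃ Regular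
    ; _≈_ = λ x y → proj₁ x ≡ proj₁ y
    ; _≤_ = λ x y → proj₁ x ⊆ proj₁ y
    ; _∨_ = λ (x , reg-x) (y , reg-y) → x ⊔ y , ⊔-regular reg-x reg-y
    ; _∧_ = λ (x , _) (y , _) → x ⊓ y , reg-regular _
    ; isLattice = record
      { isPartialOrder = record
        { isPreorder = record
          { isEquivalence = record { refl = refl ; sym = sym ; trans = trans }
          ; reflexive = λ eq {s} s∈ → subst (s ∈_) eq s∈
          ; trans = λ x⊆y y⊆z s∈ → y⊆z (x⊆y s∈)
          }
        ; antisym = λ x⊆y y⊆x → ⊆-antisym x⊆y y⊆x
        }
      ; supremum = λ (x , _) (y , _) →
          x⊆x⊔y x y , y⊆x⊔y x y , λ (_ , reg-z) → ⊔-least (regular-closed reg-z)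
      ; infimum = λ (x , reg-x) (y , reg-y) →
          x⊓y⊆x reg-x y , x⊓y⊆y x reg-y , λ (_ , reg-z) → ⊓-greatest reg-z
      }
    }

  private module R = Alg.Lattice (OrdLatticeProperties.algLattice regLattice)

  -- Each subset yields two generators, evaluated to a regular closed set and its
  -- orthocomplement: the dual of a term is then again a term over the generators.
  X : Set
  X = Subset size × Bool

  open FreeLattice X

  eval : Term X → ∃ Regular
  eval (var (x , false)) = reg x , reg-regular x
  eval (var (x , true))  = reg x ᵖ , ᵖ-regular (reg-regular x)
  eval (t ∨ₜ u) = eval t R.∨ eval u
  eval (t ∧ₜ u) = eval t R.∧ eval u

  f : Term X → Subset size
  f = proj₁ ∘ eval

  f-regular : ∀ t → Regular (f t)
  f-regular = proj₂ ∘ eval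

  f-cong : ∀ {t u} → t ≈ₜ u → f t ≡ f u
  f-cong refl≈ = refl
  f-cong (sym≈ e) = sym (f-cong e)
  f-cong (trans≈ d e) = trans (f-cong d) (f-cong e)
  f-cong (∨-cong d e) = cong₂ _⊔_ (f-cong d) (f-cong e)
  f-cong (∧-cong d e) = cong₂ _⊓_ (f-cong d) (f-cong e)
  f-cong (∨-assoc t u v) = R.∨-assoc (eval t) (eval u) (eval v)
  f-cong (∧-assoc t u v) = R.∧-assoc (eval t) (eval u) (eval v)
  f-cong (∨-comm t u) = R.∨-comm (eval t) (eval u)
  f-cong (∧-comm t u) = R.∧-comm (eval t) (eval u)
  f-cong (∨-absorbs-∧ t u) = R.∨-absorbs-∧ (eval t) (eval u)
  f-cong (∧-absorbs-∨ t u) = R.∧-absorbs-∨ (eval t) (eval u)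

  f-mono : ∀ {t u} → t ≤ u → f t ⊆ f u
  f-mono {t} {u} t≤u = subst (_⊆ f u) (sym (f-cong t≤u)) (x⊓y⊆y (f t) (f-regular u))

  ⊆-f-⋀ : ∀ {x s ts} → Regular x → x ⊆ f s → All (λ t → x ⊆ f t) ts → x ⊆ f (⋀ s ts)
  ⊆-f-⋀ reg-x x⊆s [] = x⊆s
  ⊆-f-⋀ {s = s} {t ∷ ts} reg-x x⊆s (x⊆t ∷ x⊆ts) =
    ⊓-greatest {f t} {f (⋀ s ts)} reg-x x⊆t (⊆-f-⋀ {s = s} {ts} reg-x x⊆s x⊆ts)

  -- Lower bounds

  generators : List X
  generators = cartesianProduct (subsets size) (false ∷ true ∷ [])

  ∈-generators : ∀ x → x ∈ˡ generators
  ∈-generators (x , false) = ∈-cartesianProduct⁺ (∈-subsets x) (here refl)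
  ∈-generators (x , true)  = ∈-cartesianProduct⁺ (∈-subsets x) (there (here refl))

  -- With finitely many generators, their meet is the least element of the free lattice.
  ⊥ₜ : Term X
  ⊥ₜ = ⋀ (var (⊥ , false)) (map var generators)

  ⊥ₜ-≤ : ∀ t → ⊥ₜ ≤ t
  ⊥ₜ-≤ (var x) = ⋀-≤ (∈-map⁺ var (∈-generators x))
  ⊥ₜ-≤ (t ∨ₜ u) = ≤-trans (⊥ₜ-≤ t) (x≤x∨y t u)
  ⊥ₜ-≤ (t ∧ₜ u) = ∧-greatest (⊥ₜ-≤ t) (⊥ₜ-≤ u)

  module _ (g : Subset size → Term X) where

    joins : List (Term X)
    joins = cartesianProductWith (λ V W → g V ∨ₜ g W) (subsets size) (subsets size)

    -- The meet of all generators and all joins `g V ∨ₜ g W` whose value contains `u`. The seed is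
    -- safe: it evaluates to `reg u`, which is `u` when `u` is regular.
    κ : Subset size → Term X
    κ u = ⋀ (var (u , false)) (filter (λ t → u ⊆? f t) (map var generators ++ joins))

    ⊆-f-κ : ∀ {u} → Regular u → u ⊆ f (κ u)
    ⊆-f-κ {u} reg-u = ⊆-f-⋀ {s = var (u , false)} {filter (λ t → u ⊆? f t) (map var generators ++ joins)}
      reg-u (λ {s} s∈ → subst (s ∈_) (sym reg-u) s∈)
      (all-filter (λ t → u ⊆? f t) (map var generators ++ joins))

    κ-≤-var : ∀ {u} x → u ⊆ f (var x) → κ u ≤ var x
    κ-≤-var {u} x u⊆ =
      ⋀-≤ (∈-filter⁺ (λ t → u ⊆? f t) (∈-++⁺ˡ (∈-map⁺ var (∈-generators x))) u⊆)

    κ-≤-join : ∀ {u} V W → u ⊆ f (g V) ⊔ f (g W) → κ u ≤ g V ∨ₜ g W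
    κ-≤-join {u} V W u⊆ = ⋀-≤ (∈-filter⁺ (λ t → u ⊆? f t)
      (∈-++⁺ʳ (map var generators)
        (∈-cartesianProductWith⁺ (λ V W → g V ∨ₜ g W) (∈-subsets V) (∈-subsets W))) u⊆)

  Admissible : ℕ → Subset size → Subset size → Set
  Admissible k V u = u ⊆ V × ∃ λ p → rank p ℕ.≤ k × Key u p

  admissible? : ∀ k V → Decidable (Admissible k V)
  admissible? k V u = (u ⊆? V) ×-dec any? (λ p → (rank p ℕ.≤? k) ×-dec key? u p)

  -- γ k V is the least term whose value contains the keys of rank below k inside V.
  γ : ℕ → Subset size → Term X
  γ zero    V = ⊥ₜ
  γ (suc k) V = ⋁ₜ ⊥ₜ (map (κ (γ k)) (filter (admissible? k V) (subsets size)))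

  -- A key of `p` inside `int V` is admissible, and the value of its `κ` term, a joinand of `γ`,
  -- contains it.
  ∈-f-γ : ∀ k {V p} → rank p ℕ.< k → p ∈ int V → p ∈ f (γ k V)
  ∈-f-γ (suc k) {V} {p} (s≤s r≤k) p∈ with key-inside (int V) (int-open V) p∈
  ... | u , u⊆ , key = f-mono {κ (γ k) u} {γ (suc k) V}
    (≤-⋁ (∈-map⁺ (κ (γ k))
      (∈-filter⁺ (admissible? k V) (∈-subsets u) ((λ s∈ → int-⊆ (u⊆ s∈)) , p , r≤k , key))))
    (⊆-f-κ (γ k) (key-regular key) (proj₁ key))

  mutual

    γ-≤ : ∀ k {V} t → V ⊆ f t → γ k V ≤ t
    γ-≤ zero        t V⊆ = ⊥ₜ-≤ t
    γ-≤ (suc k) {V} t V⊆ = ⋁-least (⊥ₜ-≤ t) each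
      where
      each : ∀ {s} → s ∈ˡ map (κ (γ k)) (filter (admissible? k V) (subsets size)) → s ≤ t
      each s∈ with ∈-map⁻ (κ (γ k)) s∈
      ... | u , u∈ , refl with ∈-filter⁻ (admissible? k V) {xs = subsets size} u∈
      ... | _ , u⊆V , _ , r≤k , key = κ-≤ k r≤k key t (λ s∈ → V⊆ (u⊆V s∈))

    -- Induction on `t`. Only a join containing `u` with neither joinand containing it needs more:
    -- its joinands are replaced by their `γ k` approximations, whose join is one of the meetands of
    -- `κ`.
    κ-≤ : ∀ k {u p} → rank p ℕ.≤ k → Key u p → ∀ t → u ⊆ f t → κ (γ k) u ≤ t
    κ-≤ k r≤k key (var x) u⊆ = κ-≤-var (γ k) x u⊆
    κ-≤ k r≤k key (t ∧ₜ v) u⊆ = ∧-greatest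
      (κ-≤ k r≤k key t (λ s∈ → x⊓y⊆x (f-regular t) (f v) (u⊆ s∈)))
      (κ-≤ k r≤k key v (λ s∈ → x⊓y⊆y (f t) (f-regular v) (u⊆ s∈)))
    κ-≤ k {u} r≤k key (t ∨ₜ v) u⊆ with u ⊆? f t | u ⊆? f v
    ... | yes u⊆t | _       = ≤-trans (κ-≤ k r≤k key t u⊆t) (x≤x∨y t v)
    ... | no _    | yes u⊆v = ≤-trans (κ-≤ k r≤k key v u⊆v) (y≤x∨y t v)
    ... | no u⊈t  | no u⊈v  = ≤-trans (κ-≤-join (γ k) (f t) (f v) covered)
      (∨-least (≤-trans (γ-≤ k t id) (x≤x∨y t v)) (≤-trans (γ-≤ k v id) (y≤x∨y t v)))
      where
      V W : Subset size
      V = f (γ k (f t))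
      W = f (γ k (f v))
      covered : u ⊆ V ⊔ W
      -- The refined cover uses points strictly below `p`, hence of rank below `k`, and these are
      -- captured by `γ k`.
      covered s∈ = φ-least (cl-closed (V ∪ W))
        (λ { (inj₁ x∈ , x<p) → x⊆x⊔y V W (∈-f-γ k (<-≤-trans (rank-mono x<p) r≤k) x∈)
           ; (inj₂ x∈ , x<p) → y⊆x⊔y V W (∈-f-γ k (<-≤-trans (rank-mono x<p) r≤k) x∈) })
        (key-cover key (f-regular t) (f-regular v) u⊈t u⊈v u⊆ s∈)

  lowerBound : ∀ t → ∃ λ b → f b ≡ f t × (∀ u → f u ≡ f t → b ≤ₜ u)
  lowerBound t = b , ⊆-antisym (f-mono {b} {t} (γ-≤ K t id)) f⊆ ,
    -- The order on terms unfolds to `b ≈ₜ b ∧ₜ u`, the reverse of the equation in `≤ₜ`.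
    λ u eq → sym≈ (γ-≤ K u λ {s} s∈ → subst (s ∈_) (sym eq) s∈)
    where
    K : ℕ
    -- Ranks are at most `size`, so every point has rank below `K`.
    K = suc size
    b : Term X
    b = γ K (f t)
    f⊆ : f t ⊆ f b
    f⊆ {s} s∈ = cl-least (regular-closed (f-regular b))
      (λ {p} p∈ → ∈-f-γ K (s≤s (rank-≤ p)) p∈)
      (subst (s ∈_) (sym (f-regular t)) s∈)

  -- Upper bounds by duality

  dual : Term X → Term X
  dual (var (x , false)) = var (x , true)
  dual (var (x , true))  = var (x , false)
  dual (t ∨ₜ u) = dual t ∧ₜ dual u
  dual (t ∧ₜ u) = dual t ∨ₜ dual u

  dual-involutive : ∀ t → dual (dual t) ≡ t
  dual-involutive (var (x , false)) = refl
  dual-involutive (var (x , true))  = refl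
  dual-involutive (t ∨ₜ u) = cong₂ _∨ₜ_ (dual-involutive t) (dual-involutive u)
  dual-involutive (t ∧ₜ u) = cong₂ _∧ₜ_ (dual-involutive t) (dual-involutive u)

  dual-cong : ∀ {t u} → t ≈ₜ u → dual t ≈ₜ dual u
  dual-cong refl≈ = refl≈
  dual-cong (sym≈ e) = sym≈ (dual-cong e)
  dual-cong (trans≈ d e) = trans≈ (dual-cong d) (dual-cong e)
  dual-cong (∨-cong d e) = ∧-cong (dual-cong d) (dual-cong e)
  dual-cong (∧-cong d e) = ∨-cong (dual-cong d) (dual-cong e)
  dual-cong (∨-assoc t u v) = ∧-assoc _ _ _
  dual-cong (∧-assoc t u v) = ∨-assoc _ _ _
  dual-cong (∨-comm t u) = ∧-comm _ _
  dual-cong (∧-comm t u) = ∨-comm _ _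
  dual-cong (∨-absorbs-∧ t u) = ∧-absorbs-∨ _ _
  dual-cong (∧-absorbs-∨ t u) = ∨-absorbs-∧ _ _

  -- The dual of `t ∧ₜ u ≈ₜ t` rewrites `dual t` as a join with `dual u`; absorption finishes.
  dual-antitone : ∀ {t u} → t ≤ₜ u → dual u ≤ₜ dual t
  dual-antitone {t} {u} t≤u = trans≈ (∧-cong refl≈ (trans≈ (sym≈ (dual-cong t≤u)) (∨-comm _ _)))
                                     (∧-absorbs-∨ (dual u) (dual t))

  -- For the inclusion from left to right, `x` and `y` both lie in `(x ᵖ ⊓ y ᵖ) ᵖ`, hence so does
  -- `x ⊔ y`; orthocomplementing once more gives the claim.
  ᵖ-⊔ : ∀ {x y} → Regular x → Regular y → x ᵖ ⊓ y ᵖ ≡ (x ⊔ y) ᵖ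
  ᵖ-⊔ {x} {y} reg-x reg-y = ⊆-antisym
    (subst (_⊆ (x ⊔ y) ᵖ) (reg-regular _)
      (ᵖ-antitone (⊔-least (cl-closed _) (below reg-x (x⊓y⊆x (ᵖ-regular reg-x) (y ᵖ)))
                                         (below reg-y (x⊓y⊆y (x ᵖ) (ᵖ-regular reg-y))))))
    (⊓-greatest (ᵖ-regular (⊔-regular reg-x reg-y))
      (ᵖ-antitone (x⊆x⊔y x y)) (ᵖ-antitone (y⊆x⊔y x y)))
    where
    below : ∀ {x z} → Regular x → z ⊆ x ᵖ → x ⊆ z ᵖ
    below {x} {z} reg-x z⊆ = subst (_⊆ z ᵖ) (ᵖ-involutive reg-x) (ᵖ-antitone z⊆)

  ᵖ-⊓ : ∀ {x y} → Regular x → Regular y → x ᵖ ⊔ y ᵖ ≡ (x ⊓ y) ᵖ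
  ᵖ-⊓ {x} {y} reg-x reg-y = begin
    x ᵖ ⊔ y ᵖ            ≡⟨ sym (ᵖ-involutive (⊔-regular reg-xᵖ reg-yᵖ)) ⟩
    (x ᵖ ⊔ y ᵖ) ᵖ ᵖ      ≡⟨ cong _ᵖ (sym (ᵖ-⊔ reg-xᵖ reg-yᵖ)) ⟩
    (x ᵖ ᵖ ⊓ y ᵖ ᵖ) ᵖ    ≡⟨ cong _ᵖ (cong₂ _⊓_ (ᵖ-involutive reg-x) (ᵖ-involutive reg-y)) ⟩
    (x ⊓ y) ᵖ            ∎
    where
    open ≡-Reasoning
    reg-xᵖ = ᵖ-regular reg-x
    reg-yᵖ = ᵖ-regular reg-y

  f-dual : ∀ t → f (dual t) ≡ f t ᵖ
  f-dual (var (x , false)) = refl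
  f-dual (var (x , true))  = sym (ᵖ-involutive (reg-regular x))
  f-dual (t ∨ₜ u) = trans (cong₂ _⊓_ (f-dual t) (f-dual u)) (ᵖ-⊔ (f-regular t) (f-regular u))
  f-dual (t ∧ₜ u) = trans (cong₂ _⊔_ (f-dual t) (f-dual u)) (ᵖ-⊓ (f-regular t) (f-regular u))

  -- `dual` is an order-reversing involution exchanging the fibres of `f` through `t` and `dual t`,
  -- so it sends the least term of one to the greatest of the other.
  upperBound : ∀ t → ∃ λ b → f b ≡ f t × (∀ u → f u ≡ f t → u ≤ₜ b)
  upperBound t with b , fb≡ , least ← lowerBound (dual t) =
    dual b ,
    trans (f-dual b) (trans (cong _ᵖ (trans fb≡ (f-dual t))) (ᵖ-involutive (f-regular t))) ,
    λ u eq → subst (_≤ₜ dual b) (dual-involutive u)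
      (dual-antitone (least (dual u) (trans (f-dual u) (trans (cong _ᵖ eq) (sym (f-dual t))))))

theorem11p2 : (S : FinJoinSemilattice) → IsBoundedHomImageOfFreeLattice S
theorem11p2 S = X , record
  { f          = f
  ; f-reg      = λ t → regular⇒isRegClosed (f-regular t)
  ; f-wd       = f-cong
  ; f-∨        = λ t u → ∈-⊔ (f t) (f u)
  ; f-∧        = λ t u → ∈-⊓ (f t) (f u)
  -- The generator evaluates to `reg x`, which equals `x` by regularity.
  ; surjective = λ x h → var (x , false) , isRegClosed⇒regular h
  ; lower      = lowerBound
  ; upper      = upperBound
  }
  where
  open RegularClosed S
  open Evaluation S
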